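{- Let $n,m\ge 1$, and consider the $m$-row shapes $\lambda=(n,\dots,n)$ (with $m$ rows of length $n$) and $\widetilde{\lambda}=(n+1,n,\dots,n,n-1)$ (first row of length $n+1$, last row of length $n-1$, all other rows of length $n$). Then $|S_1(\lambda)|=|S_0(\widetilde{\lambda})|$.
   Context: For a shape $\mu=(\mu_1,\dots,\mu_k)$ (non-increasing, rows of length zero omitted) with $N=\sum\mu_i$ boxes, a tableau of shape $\mu$ is a bijective filling of the left-justified Young diagram with $1,\dots,N$; it is row-standard if entries increase left to right along each row. For a row-standard tableau $\tau$, a pair of entries $i<j$ in the same column is an inversion if either (1) $i$ or $j$ has no entry immediately to its right and $i$ lies below $j$, or (2) $i$ is immediately followed on its right by $i'$, $j$ is immediately followed on its right by $j'$, and $i'>j'$. $S_i(\mu)$ is the set of row-standard tableaux of shape $\mu$ with exactly $i$ inversions; in particular $S_0(\mu)$ is the set of standard Young tableaux of shape $\mu$.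
   Formalization: The theorem is stated for m ≥ 2 instead of m ≥ 1: for m = 1 the first and last rows of the second shape coincide, so it is undefined, and reading it as any one-row shape makes the claim false (0 on the left, 1 on the right). -}

module Defs where

open import Data.Nat using (ℕ; zero; suc; _+_; _<_; _<ᵇ_)
open import Data.Nat.ListAction using (sum)
open import Data.Bool using (Bool; true; false; if_then_else_)
open import Data.Maybe using (Maybe; just; nothing)
open import Data.Product using (Σ; _×_; _,_)
open import Data.List using (List; []; _∷_; _++_; map; length; concat; zip; upTo; replicate)
open import Data.List.Relation.Unary.Linked using (Linked)
open import Data.List.Relation.Unary.All using (All)
open import Data.List.Relation.Unary.Unique.Propositional using (Unique)
open import Data.List.Membership.Propositional using (_∈_)
open import Data.List.Relation.Binary.Permutation.Propositional using (_↭_)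
open import Function.Bundles using (_⇔_)
open import Relation.Binary.PropositionalEquality using (_≡_)

-- A shape is a list of (positive, non-increasing) row lengths.
Shape : Set
Shape = List ℕ

-- A tableau is given by its rows, top to bottom, each read left to right.
Tableau : Set
Tableau = List (List ℕ)

boxes : Shape → ℕ
boxes μ = sum μ

IsTableau : Shape → Tableau → Set
IsTableau μ T = (map length T ≡ μ) × (concat T ↭ map suc (upTo (boxes μ)))

RowStandard : Tableau → Set
RowStandard T = All (Linked _<_) T

withRight : List ℕ → List (ℕ × Maybe ℕ)
withRight []           = []
withRight (x ∷ [])     = (x , nothing) ∷ []
withRight (x ∷ y ∷ xs) = (x , just y) ∷ withRight (y ∷ xs)

-- Inversion test for two entries in the same column, u in an upper row,
-- v in a lower row (each with its right neighbour).
-- If x < y then i = x (upper), j = y (lower): condition (1) fails since i is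
-- above j, condition (2) is x' > y'.
-- If y < x then i = y (lower), j = x (upper): condition (1) holds when some
-- right neighbour is missing; otherwise condition (2) is y' > x'.
pairInv : ℕ × Maybe ℕ → ℕ × Maybe ℕ → ℕ
pairInv (x , just x') (y , just y') =
  if x <ᵇ y then (if y' <ᵇ x' then 1 else 0) else (if x' <ᵇ y' then 1 else 0)
pairInv (x , _) (y , _) = if x <ᵇ y then 0 else 1

-- inversions between an upper row and a lower row (common columns only,
-- the diagram being left-justified)
rowPairInv : List ℕ → List ℕ → ℕ
rowPairInv r s = sum (map (λ p → pairInv (Data.Product.proj₁ p) (Data.Product.proj₂ p))
                          (zip (withRight r) (withRight s)))

inversions : Tableau → ℕ
inversions []      = 0
inversions (r ∷ T) = sum (map (rowPairInv r) T) + inversions T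

S : ℕ → Shape → Tableau → Set
S i μ T = IsTableau μ T × RowStandard T × (inversions T ≡ i)

HasCard : (Tableau → Set) → ℕ → Set
HasCard P k = Σ (List Tableau) λ L → Unique L × (∀ T → (T ∈ L) ⇔ P T) × (length L ≡ k)

rectangle : ℕ → ℕ → Shape
rectangle n m = replicate m n

-- λ̃ = (n+1, n, …, n, n-1) with m = k+2 rows, n = n'+1;
-- a last row of length 0 (n = 1) is omitted.
lastRow : ℕ → Shape
lastRow zero    = []
lastRow (suc r) = suc r ∷ []

modified : ℕ → ℕ → Shape
modified n' k = (suc (suc n') ∷ replicate k (suc n')) ++ lastRow n'

private
  test1 : inversions ((2 ∷ 3 ∷ []) ∷ (1 ∷ 4 ∷ []) ∷ []) ≡ 1
  test1 = Relation.Binary.PropositionalEquality.refl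
  test2 : inversions ((2 ∷ []) ∷ (1 ∷ []) ∷ []) ≡ 1
  test2 = Relation.Binary.PropositionalEquality.refl
  test3 : inversions ((1 ∷ 2 ∷ []) ∷ (3 ∷ 4 ∷ []) ∷ []) ≡ 0
  test3 = Relation.Binary.PropositionalEquality.refl

{-# OPTIONS --safe #-}

-- Deleting the largest entry of a tableau with one inversion either leaves such a tableau, or the
-- entry ends row i while row i + 1 is equally long; then exchanging these two rows removes the
-- inversion, and deleting the entry gives a standard tableau.  With F N x the number of standard
-- tableaux of shape x (0 outside the Weyl chamber) and R N x the number with one inversion:
--
--   F (N + 1) x = Σ_i F N (x - e_i)
--   R (N + 1) x = Σ_i R N (x - e_i) + Σ_{x_i = x_{i+1}} F N (x - e_{i+1})
--
-- Inside the chamber R agrees with G N x = Σ_{r<s} F N (x + e_r - e_s), because G satisfies the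
-- second recursion too: expanding each summand by the first one, the terms that leave the chamber
-- telescope.  For a rectangle only the summand with r the first and s the last row is nonzero.

module Submission where

open import Defs
open import Data.Nat as ℕ using (ℕ; zero; suc; _+_; _*_; _≤_; _<_; _<ᵇ_; z≤n; s≤s)
import Data.Nat.Properties as ℕₚ
open import Data.Nat.ListAction using (sum)
open import Data.Nat.ListAction.Properties using (sum-++; sum-↭)
import Data.Nat.Tactic.RingSolver as ℕSolver
open import Data.Integer as ℤ using (ℤ; -[1+_]; 0ℤ; 1ℤ)
import Data.Integer.Properties as ℤₚ
import Data.Integer.Tactic.RingSolver as ℤSolver
import Algebra.Properties.AbelianGroup ℤₚ.+-0-abelianGroup as ℤ+
open import Data.Bool using (true; false; if_then_else_)
open import Data.Bool.Properties using (T-≡)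
open import Data.Empty using (⊥)
open import Data.Maybe using (just; nothing)
open import Data.Product as Product using (Σ; ∃; _×_; _,_; proj₁; proj₂)
open import Data.Sum using (_⊎_; inj₁; inj₂; [_,_]′)
open import Data.List using (List; []; _∷_; _++_; _∷ʳ_; map; length; concat; upTo; replicate)
open import Data.List.Properties
  using (length-map; length-++; length-replicate; map-++; concat-++; upTo-∷ʳ; ++-identityʳ;
         ++-conicalˡ; ++-conicalʳ; ∷-injective; ∷ʳ-injectiveˡ)
open import Data.List.Membership.Propositional using (_∈_)
open import Data.List.Membership.Propositional.Properties using (∈-++⁺ˡ; ∈-++⁺ʳ; ∈-++⁻; ∈-map⁺; ∈-map⁻)
open import Data.List.Relation.Unary.Any using (here; there)
open import Data.List.Relation.Unary.All as All using (All; []; _∷_)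
import Data.List.Relation.Unary.All.Properties as All
open import Data.List.Relation.Unary.AllPairs using (AllPairs; []; _∷_)
open import Data.List.Relation.Unary.Linked using (Linked; []; [-]; _∷_)
import Data.List.Relation.Unary.Linked.Properties as Linked
open import Data.List.Relation.Unary.Unique.Propositional using (Unique)
import Data.List.Relation.Unary.Unique.Propositional.Properties as Unique
open import Data.List.Relation.Binary.Permutation.Propositional as ↭
  using (_↭_; ↭-sym; ↭-trans; ↭-refl; prep; swap; ↭⇒↭ₛ)
import Data.List.Relation.Binary.Permutation.Propositional.Properties as ↭
import Data.List.Relation.Binary.Permutation.Setoid.Properties as ↭ₛ
open import Function using (_∘_)
open import Function.Bundles using (mk⇔; Equivalence)
open import Relation.Nullary using (¬_; Dec; yes; no; does; contradiction)
open import Relation.Nullary.Decidable using (_×-dec_)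
open import Relation.Binary using (tri<; tri≈; tri>)
open import Relation.Binary.PropositionalEquality

open Equivalence using (to; from)

-- Walks in the Weyl chamber

𝟙 : ∀ {a} {A : Set a} → Dec A → ℕ
𝟙 a? = if does a? then 1 else 0

𝟙-yes : ∀ {a} {A : Set a} (a? : Dec A) → A → 𝟙 a? ≡ 1
𝟙-yes (yes _) _ = refl
𝟙-yes (no ¬a) a = contradiction a ¬a

𝟙-no : ∀ {a} {A : Set a} (a? : Dec A) → ¬ A → 𝟙 a? ≡ 0
𝟙-no (yes a) ¬a = contradiction a ¬a
𝟙-no (no _)  _  = refl

𝟙-cong : ∀ {a b} {A : Set a} {B : Set b} (a? : Dec A) (b? : Dec B) → (A → B) → (B → A) → 𝟙 a? ≡ 𝟙 b?
𝟙-cong (yes a) b? f g = sym (𝟙-yes b? (f a))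
𝟙-cong (no ¬a) b? f g = sym (𝟙-no b? λ b → ¬a (g b))

∑ : ℕ → (ℕ → ℕ) → ℕ
∑ zero    f = 0
∑ (suc n) f = ∑ n f + f n

∑-cong : ∀ n {f g} → (∀ i → i < n → f i ≡ g i) → ∑ n f ≡ ∑ n g
∑-cong zero    eq = refl
∑-cong (suc n) eq = cong₂ _+_ (∑-cong n λ i i<n → eq i (ℕₚ.m<n⇒m<1+n i<n)) (eq n ℕₚ.≤-refl)

∑-zero : ∀ n {f} → (∀ i → i < n → f i ≡ 0) → ∑ n f ≡ 0
∑-zero zero    eq = refl
∑-zero (suc n) eq = cong₂ _+_ (∑-zero n λ i i<n → eq i (ℕₚ.m<n⇒m<1+n i<n)) (eq n ℕₚ.≤-refl)

∑-+ : ∀ n f g → ∑ n (λ i → f i + g i) ≡ ∑ n f + ∑ n g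
∑-+ zero    f g = refl
∑-+ (suc n) f g rewrite ∑-+ n f g = lem (∑ n f) (∑ n g) (f n) (g n)
  where
  lem : ∀ a b c d → a + b + (c + d) ≡ a + c + (b + d)
  lem = ℕSolver.solve-∀

∑-*ˡ : ∀ n c f → ∑ n (λ i → c * f i) ≡ c * ∑ n f
∑-*ˡ zero    c f = sym (ℕₚ.*-zeroʳ c)
∑-*ˡ (suc n) c f rewrite ∑-*ˡ n c f = sym (ℕₚ.*-distribˡ-+ c (∑ n f) (f n))

∑-*ʳ : ∀ n c f → ∑ n (λ i → f i * c) ≡ ∑ n f * c
∑-*ʳ zero    c f = refl
∑-*ʳ (suc n) c f rewrite ∑-*ʳ n c f = sym (ℕₚ.*-distribʳ-+ c (∑ n f) (f n))

∑-swap : ∀ m n (f : ℕ → ℕ → ℕ) → ∑ m (λ i → ∑ n (f i)) ≡ ∑ n (λ j → ∑ m (λ i → f i j))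
∑-swap zero    n f = sym (∑-zero n λ _ _ → refl)
∑-swap (suc m) n f rewrite ∑-swap m n f = sym (∑-+ n (λ j → ∑ m (λ i → f i j)) (f m))

∑-head : ∀ n f → ∑ (suc n) f ≡ f 0 + ∑ n (λ i → f (suc i))
∑-head zero    f = sym (ℕₚ.+-identityʳ (f 0))
∑-head (suc n) f = trans (cong (_+ f (suc n)) (∑-head n f)) (ℕₚ.+-assoc (f 0) _ _)

∑-single : ∀ n {f} k → k < n → (∀ i → i < n → i ≢ k → f i ≡ 0) → ∑ n f ≡ f k
∑-single (suc n) {f} k k<1+n off with k ℕ.≟ n
... | yes refl = cong (_+ f n) (∑-zero n λ i i<n → off i (ℕₚ.m<n⇒m<1+n i<n) (ℕₚ.<⇒≢ i<n))
... | no k≢n = trans (cong₂ _+_ (∑-single n k (ℕₚ.≤∧≢⇒< (ℕₚ.≤-pred k<1+n) k≢n)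
                                   λ i i<n → off i (ℕₚ.m<n⇒m<1+n i<n))
                                (off n ℕₚ.≤-refl (≢-sym k≢n)))
                     (ℕₚ.+-identityʳ (f k))

∑-pair : ∀ n {f} k l → k < l → l < n → (∀ i → i < n → i ≢ k → i ≢ l → f i ≡ 0) → ∑ n f ≡ f k + f l
∑-pair (suc n) {f} k l k<l l<1+n off with l ℕ.≟ n
... | yes refl = cong (_+ f n) (∑-single n k k<l λ i i<n i≢k → off i (ℕₚ.m<n⇒m<1+n i<n) i≢k (ℕₚ.<⇒≢ i<n))
... | no l≢n = trans (cong₂ _+_ (∑-pair n k l k<l l<n λ i i<n → off i (ℕₚ.m<n⇒m<1+n i<n))
                                (off n ℕₚ.≤-refl (≢-sym (ℕₚ.<⇒≢ (ℕₚ.<-trans k<l l<n))) (≢-sym l≢n)))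
                     (ℕₚ.+-identityʳ _)
  where l<n = ℕₚ.≤∧≢⇒< (ℕₚ.≤-pred l<1+n) l≢n

Point : Set
Point = ℕ → ℤ

infix 4 _≐_
_≐_ : Point → Point → Set
x ≐ y = ∀ j → x j ≡ y j

infixl 6 _⊕_ _⊖_
_⊕_ _⊖_ : Point → Point → Point
(x ⊕ y) j = x j ℤ.+ y j
(x ⊖ y) j = x j ℤ.- y j

opaque
  δ : ℕ → Point
  δ i j = ℤ.+ 𝟙 (i ℕ.≟ j)

  δ-refl : ∀ i → δ i i ≡ 1ℤ
  δ-refl i = cong ℤ.+_ (𝟙-yes (i ℕ.≟ i) refl)

  δ-off : ∀ {i j} → i ≢ j → δ i j ≡ 0ℤ
  δ-off {i} {j} i≢j = cong ℤ.+_ (𝟙-no (i ℕ.≟ j) i≢j)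

  0≤δ : ∀ i j → 0ℤ ℤ.≤ δ i j
  0≤δ i j = ℤ.+≤+ z≤n

δ-pred : ∀ i → δ i (suc i) ≡ 0ℤ
δ-pred i = δ-off (ℕₚ.<⇒≢ (ℕₚ.n<1+n i))

x-δ≤x : ∀ x i j → x ℤ.- δ i j ℤ.≤ x
x-δ≤x x i j = subst (x ℤ.- δ i j ℤ.≤_) (ℤₚ.+-identityʳ x) (ℤₚ.+-monoʳ-≤ x (ℤₚ.neg-mono-≤ (0≤δ i j)))

module Walks (M : ℕ) where

  Chamber : Point → Set
  Chamber x = ∀ {j} → j < M → x (suc j) ℤ.≤ x j

  chamber? : ∀ x → Dec (Chamber x)
  chamber? x = ℕₚ.allUpTo? (λ j → x (suc j) ℤₚ.≤? x j) M

  Origin : Point → Set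
  Origin x = ∀ {j} → j < suc M → x j ≡ 0ℤ

  origin? : ∀ x → Dec (Origin x)
  origin? x = ℕₚ.allUpTo? (λ j → x j ℤₚ.≟ 0ℤ) (suc M)

  Flat : Point → ℕ → Set
  Flat x p = p < M × x p ≡ x (suc p)

  opaque
    flat? : ∀ x p → Dec (Flat x p)
    flat? x p = (p ℕₚ.<? M) ×-dec (x p ℤₚ.≟ x (suc p))

  -- Nonnegativity of the coordinates need not be imposed: every walk starts at the origin.
  F : ℕ → Point → ℕ
  F zero    x = 𝟙 (origin? x)
  F (suc N) x = 𝟙 (chamber? x) * ∑ (suc M) (λ i → F N (x ⊖ δ i))

  R : ℕ → Point → ℕ
  R zero    x = 0
  R (suc N) x = 𝟙 (chamber? x) *
    ∑ (suc M) (λ i → R N (x ⊖ δ i) + 𝟙 (flat? x i) * F N (x ⊖ δ (suc i)))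

  G : ℕ → Point → ℕ
  G N x = ∑ (suc M) λ s → ∑ s λ r → F N (x ⊕ (δ r ⊖ δ s))

  chamber-cong : ∀ {x y} → x ≐ y → Chamber x → Chamber y
  chamber-cong x≐y Cx {j} j<M = subst₂ ℤ._≤_ (x≐y (suc j)) (x≐y j) (Cx j<M)

  F-cong : ∀ N {x y} → x ≐ y → F N x ≡ F N y
  F-cong zero {x} {y} x≐y = 𝟙-cong (origin? x) (origin? y)
    (λ Ox {j} j<m → trans (sym (x≐y j)) (Ox j<m)) (λ Oy {j} j<m → trans (x≐y j) (Oy j<m))
  F-cong (suc N) {x} {y} x≐y = cong₂ _*_
    (𝟙-cong (chamber? x) (chamber? y) (chamber-cong x≐y) (chamber-cong λ j → sym (x≐y j)))
    (∑-cong (suc M) λ i _ → F-cong N λ j → cong (ℤ._- δ i j) (x≐y j))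

  F-outside : ∀ N {x} → ¬ Chamber x → F N x ≡ 0
  F-outside zero {x} ¬C = 𝟙-no (origin? x) λ Ox → ¬C λ j<M →
    ℤₚ.≤-reflexive (trans (Ox (s≤s j<M)) (sym (Ox (ℕₚ.m<n⇒m<1+n j<M))))
  F-outside (suc N) {x} ¬C rewrite 𝟙-no (chamber? x) ¬C = refl

  R-outside : ∀ N {x} → ¬ Chamber x → R N x ≡ 0
  R-outside zero    ¬C = refl
  R-outside (suc N) {x} ¬C rewrite 𝟙-no (chamber? x) ¬C = refl

  F-suc : ∀ N {x} → Chamber x → F (suc N) x ≡ ∑ (suc M) (λ i → F N (x ⊖ δ i))
  F-suc N {x} Cx rewrite 𝟙-yes (chamber? x) Cx = ℕₚ.*-identityˡ _

  broken : ∀ {x u j} → Flat x j → u j ℤ.< u (suc j) → ¬ Chamber (x ⊕ u)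
  broken {x} {u} {j} (j<M , eq) lt C = ℤₚ.<⇒≱ (ℤₚ.+-monoʳ-< (x j) lt)
    (subst (λ z → z ℤ.+ u (suc j) ℤ.≤ x j ℤ.+ u j) (sym eq) (C j<M))

  unflat : ∀ {x p} → Chamber x → p < M → ¬ Flat x p → x (suc p) ℤ.< x p
  unflat Cx p<M ¬f = ℤₚ.≤∧≢⇒< (Cx p<M) λ eq → ¬f (p<M , sym eq)

  chamber-monotone : ∀ {x} → Chamber x → ∀ {r s} → r < s → s < suc M → x s ℤ.≤ x r
  chamber-monotone {x} Cx {r} {suc s} r<s s<m with ℕₚ.m≤n⇒m<n∨m≡n (ℕₚ.≤-pred r<s)
  ... | inj₁ r<s′  = ℤₚ.≤-trans (Cx (ℕₚ.≤-pred s<m)) (chamber-monotone {x} Cx r<s′ (ℕₚ.<-trans ℕₚ.≤-refl s<m))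
  ... | inj₂ refl = Cx (ℕₚ.≤-pred s<m)

  chamber-⊖δ : ∀ {x i} → Chamber x → ¬ Flat x i → Chamber (x ⊖ δ i)
  chamber-⊖δ {x} {i} Cx ¬f {j} j<M with i ℕ.≟ j
  ... | yes refl rewrite δ-refl i | δ-pred i | ℤₚ.+-identityʳ (x (suc i)) | ℤₚ.+-comm (x i) -[1+ 0 ] =
    ℤₚ.i<j⇒i≤pred[j] (unflat {x} Cx j<M ¬f)
  ... | no i≢j rewrite δ-off i≢j | ℤₚ.+-identityʳ (x j) =
    ℤₚ.≤-trans (x-δ≤x (x (suc j)) i (suc j)) (Cx j<M)

  flat-⊖δ : ∀ {x i} → Flat x i → ¬ Chamber (x ⊖ δ i)
  flat-⊖δ {x} {i} fl = broken {x} {λ j → ℤ.- δ i j} fl lt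
    where
    lt : ℤ.- δ i i ℤ.< ℤ.- δ i (suc i)
    lt rewrite δ-refl i | δ-pred i = ℤ.-<+

  module _ {μ : Point} (Cμ : Chamber μ) where

    move : ℕ → Point → Point
    move r d = μ ⊕ (δ r ⊖ d)

    raise-broken : ∀ {p d} → Flat μ p → 0ℤ ℤ.≤ d p → d (suc p) ≡ 0ℤ → ¬ Chamber (move (suc p) d)
    raise-broken {p} {d} fl 0≤d d≡0 = broken {μ} {δ (suc p) ⊖ d} fl lt
      where
      lt : δ (suc p) p ℤ.- d p ℤ.< δ (suc p) (suc p) ℤ.- d (suc p)
      lt rewrite δ-refl (suc p) | d≡0 | δ-off (ℕₚ.>⇒≢ (ℕₚ.n<1+n p)) | ℤₚ.+-identityˡ (ℤ.- d p) =
        ℤₚ.≤-<-trans (ℤₚ.neg-mono-≤ 0≤d) (ℤ.+<+ ℕₚ.≤-refl)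

    lower-broken : ∀ {r p d} → Flat μ p → r ≢ p → 1ℤ ℤ.≤ d p → d (suc p) ≡ 0ℤ → ¬ Chamber (move r d)
    lower-broken {r} {p} {d} fl r≢p 1≤d d≡0 = broken {μ} {δ r ⊖ d} fl lt
      where
      lt : δ r p ℤ.- d p ℤ.< δ r (suc p) ℤ.- d (suc p)
      lt rewrite d≡0 | δ-off r≢p | ℤₚ.+-identityˡ (ℤ.- d p) | ℤₚ.+-identityʳ (δ r (suc p)) =
        ℤₚ.≤-<-trans (ℤₚ.neg-mono-≤ 1≤d) (ℤₚ.<-≤-trans ℤ.-<+ (0≤δ r (suc p)))

    Raised : ℕ → Set
    Raised zero    = ⊥
    Raised (suc p) = Flat μ p

    raised? : ∀ r → Dec (Raised r)
    raised? zero    = no λ ()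
    raised? (suc p) = flat? μ p

    move-chamber : ∀ {r s} → r < s → ¬ Raised r → ¬ Flat μ s → Chamber (move r (δ s))
    move-chamber {r} {s} r<s ¬rr ¬fs {j} j<M with r ℕ.≟ suc j | s ℕ.≟ j
    ... | yes refl | yes refl = contradiction r<s (ℕₚ.<-asym ℕₚ.≤-refl)
    ... | yes refl | no s≢j
      rewrite δ-refl r | δ-off s≢j | δ-off (ℕₚ.>⇒≢ r<s) | δ-off (ℕₚ.>⇒≢ (ℕₚ.n<1+n j))
            | ℤₚ.+-identityʳ (μ j) | ℤₚ.+-comm (μ (suc j)) 1ℤ = ℤₚ.i<j⇒suc[i]≤j (unflat {μ} Cμ j<M ¬rr)
    ... | no r≢sj | yes refl
      rewrite δ-refl s | δ-off r≢sj | δ-off (ℕₚ.<⇒≢ r<s) | δ-pred s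
            | ℤₚ.+-identityʳ (μ (suc s)) | ℤₚ.+-comm (μ s) -[1+ 0 ] = ℤₚ.i<j⇒i≤pred[j] (unflat {μ} Cμ j<M ¬fs)
    ... | no r≢sj | no s≢j
      rewrite δ-off r≢sj | δ-off s≢j = ℤₚ.+-mono-≤ (Cμ j<M) le
      where
      le : 0ℤ ℤ.- δ s (suc j) ℤ.≤ δ r j ℤ.- 0ℤ
      le rewrite ℤₚ.+-identityʳ (δ r j) | ℤₚ.+-identityˡ (ℤ.- δ s (suc j)) =
        ℤₚ.≤-trans (ℤₚ.neg-mono-≤ (0≤δ s (suc j))) (0≤δ r j)

    move-⊖ : ∀ r s i → move r (δ s) ⊖ δ i ≐ move r (δ s ⊕ δ i)
    move-⊖ r s i j = lem (μ j) (δ r j) (δ s j) (δ i j)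
      where
      lem : ∀ a b c d → a ℤ.+ (b ℤ.- c) ℤ.- d ≡ a ℤ.+ (b ℤ.- (c ℤ.+ d))
      lem = ℤSolver.solve-∀

    move-self : ∀ r s → move r (δ s ⊕ δ r) ≐ μ ⊖ δ s
    move-self r s j = lem (μ j) (δ r j) (δ s j)
      where
      lem : ∀ a b c → a ℤ.+ (b ℤ.- (c ℤ.+ b)) ≡ a ℤ.- c
      lem = ℤSolver.solve-∀

    ⊖-move : ∀ i r s → move r (δ s ⊕ δ i) ≐ (μ ⊖ δ i) ⊕ (δ r ⊖ δ s)
    ⊖-move i r s j = lem (μ j) (δ r j) (δ s j) (δ i j)
      where
      lem : ∀ a b c d → a ℤ.+ (b ℤ.- (c ℤ.+ d)) ≡ a ℤ.- d ℤ.+ (b ℤ.- c)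
      lem = ℤSolver.solve-∀

    module _ (N : ℕ) where

      f : ℕ → Point → ℕ
      f r d = F N (move r d)

      g : ℕ → ℕ
      g s = F N (μ ⊖ δ s)

      b : ℕ → ℕ
      b p = 𝟙 (flat? μ p)

      a : ℕ → ℕ
      a r = 𝟙 (raised? r)

      Z : ℕ → ℕ → ℕ
      Z r s = ∑ (suc M) λ i → f r (δ s ⊕ δ i)

      -- A shape that is flat below row r - 1 or at row s stops being a partition under e_r - e_s, and
      -- removing e_i repairs it only for i = r, respectively i = s + 1.
      Z-moved : ∀ {r s} → r < s → s < suc M →
        Z r s ≡ F (suc N) (move r (δ s)) + (a r * g s + b s * f r (δ s ⊕ δ (suc s)))
      Z-moved {r} {s} r<s s<m with raised? r | flat? μ s
      Z-moved {suc p} {s} r<s s<m | yes fp | fs? = begin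
        Z (suc p) s
          ≡⟨ ∑-single (suc M) (suc p) (ℕₚ.<-trans r<s s<m) (λ i _ i≢ → off i≢) ⟩
        f (suc p) (δ s ⊕ δ (suc p))
          ≡⟨ F-cong N (move-self (suc p) s) ⟩
        g s
          ≡⟨ sym (trans (ℕₚ.+-identityʳ _) (ℕₚ.+-identityʳ (g s))) ⟩
        1 * g s + 0
          ≡⟨ cong ((1 * g s) +_) (sym (trans (cong (𝟙 fs? *_) (off (ℕₚ.>⇒≢ (ℕₚ.m<n⇒m<1+n r<s)))) (ℕₚ.*-zeroʳ (𝟙 fs?)))) ⟩
        1 * g s + 𝟙 fs? * f (suc p) (δ s ⊕ δ (suc s))
          ≡⟨ cong (_+ (1 * g s + 𝟙 fs? * f (suc p) (δ s ⊕ δ (suc s)))) 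
               (sym (F-outside (suc N) (raise-broken {p} {δ s} fp (0≤δ s p) (δ-off (ℕₚ.>⇒≢ r<s))))) ⟩
        F (suc N) (move (suc p) (δ s)) + (1 * g s + 𝟙 fs? * f (suc p) (δ s ⊕ δ (suc s))) ∎
        where
        open ≡-Reasoning
        off : ∀ {i} → i ≢ suc p → f (suc p) (δ s ⊕ δ i) ≡ 0
        off i≢ = F-outside N (raise-broken {p} {δ s ⊕ δ _} fp (ℤₚ.+-mono-≤ (0≤δ s p) (0≤δ _ p))
          (cong₂ ℤ._+_ (δ-off (ℕₚ.>⇒≢ r<s)) (δ-off i≢)))
      Z-moved {r} {s} r<s s<m | no ¬rr | yes fs = begin
        Z r s
          ≡⟨ ∑-single (suc M) (suc s) (s≤s (proj₁ fs)) (λ i _ i≢ → F-outside N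
               (lower-broken {r} {s} {δ s ⊕ δ i} fs (ℕₚ.<⇒≢ r<s)
                 (ℤₚ.+-mono-≤ (ℤₚ.≤-reflexive (sym (δ-refl s))) (0≤δ i s))
                 (cong₂ ℤ._+_ (δ-pred s) (δ-off i≢)))) ⟩
        f r (δ s ⊕ δ (suc s))
          ≡⟨ sym (ℕₚ.+-identityʳ _) ⟩
        1 * f r (δ s ⊕ δ (suc s))
          ≡⟨ cong (_+ (1 * f r (δ s ⊕ δ (suc s)))) (sym (F-outside (suc N) (lower-broken {r} {s} {δ s} fs (ℕₚ.<⇒≢ r<s)
               (ℤₚ.≤-reflexive (sym (δ-refl s))) (δ-pred s)))) ⟩
        F (suc N) (move r (δ s)) + 1 * f r (δ s ⊕ δ (suc s)) ∎
        where open ≡-Reasoning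
      Z-moved {r} {s} r<s s<m | no ¬rr | no ¬fs =
        trans (∑-cong (suc M) λ i _ → F-cong N λ j → sym (move-⊖ r s i j))
              (trans (sym (F-suc N (move-chamber r<s ¬rr ¬fs))) (sym (ℕₚ.+-identityʳ _)))

      w : ℕ → ℕ
      w i = 𝟙 (chamber? (μ ⊖ δ i))

      w+b : ∀ i → w i + b i ≡ 1
      w+b i with flat? μ i
      ... | yes fi = cong (_+ 1) (𝟙-no (chamber? (μ ⊖ δ i)) (flat-⊖δ {μ} fi))
      ... | no ¬fi = cong (_+ 0) (𝟙-yes (chamber? (μ ⊖ δ i)) (chamber-⊖δ {μ} Cμ ¬fi))

      Z-split : ∀ r s → Z r s ≡ ∑ (suc M) (λ i → w i * f r (δ s ⊕ δ i)) + ∑ (suc M) (λ i → b i * f r (δ s ⊕ δ i))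
      Z-split r s = trans (∑-cong (suc M) λ i _ → step i) (∑-+ (suc M) _ _)
        where
        step : ∀ i → f r (δ s ⊕ δ i) ≡ w i * f r (δ s ⊕ δ i) + b i * f r (δ s ⊕ δ i)
        step i = trans (sym (ℕₚ.*-identityˡ _)) (trans (cong (_* f r (δ s ⊕ δ i)) (sym (w+b i)))
          (ℕₚ.*-distribʳ-+ (f r (δ s ⊕ δ i)) (w i) (b i)))

      lowered-off : ∀ {r p i} → i ≢ r → i ≢ p → b i * f r (δ (suc p) ⊕ δ i) ≡ 0
      lowered-off {r} {p} {i} i≢r i≢p with flat? μ i
      ... | no _ = refl
      ... | yes fi = trans (ℕₚ.+-identityʳ _) (F-outside N (lower-broken {r} {i} {δ (suc p) ⊕ δ i} fi (≢-sym i≢r)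
                 (ℤₚ.+-mono-≤ (0≤δ (suc p) i) (ℤₚ.≤-reflexive (sym (δ-refl i))))
                 (cong₂ ℤ._+_ (δ-off λ eq → i≢p (sym (ℕₚ.suc-injective eq))) (δ-pred i))))

      lowered-self : ∀ r p → b r * f r (δ (suc p) ⊕ δ r) ≡ b r * g (suc p)
      lowered-self r p = cong (b r *_) (F-cong N (move-self r (suc p)))

      lowered : ∀ {p} → p < M →
        ∑ (suc p) (λ r → ∑ (suc M) (λ i → b i * f r (δ (suc p) ⊕ δ i)))
        ≡ ∑ (suc p) b * g (suc p) + b p * ∑ p (λ r → f r (δ p ⊕ δ (suc p)))
      lowered {p} p<M = begin
        ∑ p (λ r → ∑ (suc M) (λ i → b i * f r (δ (suc p) ⊕ δ i))) + ∑ (suc M) (λ i → b i * f p (δ (suc p) ⊕ δ i))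
          ≡⟨ cong₂ _+_ (∑-cong p λ r r<p → trans
               (∑-pair (suc M) r p r<p p<m λ i _ → lowered-off)
               (cong₂ _+_ (lowered-self r p) (cong (b p *_) (F-cong N λ j →
                 cong (λ d → μ j ℤ.+ (δ r j ℤ.- d)) (ℤₚ.+-comm (δ (suc p) j) (δ p j))))))
             (trans (∑-single (suc M) p p<m λ i _ i≢p → lowered-off i≢p i≢p) (lowered-self p p)) ⟩
        ∑ p (λ r → b r * g (suc p) + b p * f r (δ p ⊕ δ (suc p))) + b p * g (suc p)
          ≡⟨ cong (_+ (b p * g (suc p))) (trans (∑-+ p _ _) (cong₂ _+_ (∑-*ʳ p _ _) (∑-*ˡ p (b p) _))) ⟩
        ∑ p b * g (suc p) + b p * ∑ p (λ r → f r (δ p ⊕ δ (suc p))) + b p * g (suc p)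
          ≡⟨ lem (∑ p b) (g (suc p)) (b p) _ ⟩
        ∑ (suc p) b * g (suc p) + b p * ∑ p (λ r → f r (δ p ⊕ δ (suc p))) ∎
        where
        open ≡-Reasoning
        p<m = ℕₚ.m<n⇒m<1+n p<M
        lem : ∀ A g b h → A * g + b * h + b * g ≡ (A + b) * g + b * h
        lem = ℕSolver.solve-∀

      ∑b : ∀ p → ∑ (suc p) b ≡ ∑ (suc p) a + b p
      ∑b p = cong (_+ b p) (sym (∑-head p a))

      H : ℕ → ℕ
      H p = b p * ∑ p (λ r → f r (δ p ⊕ δ (suc p)))

      bM≡0 : b M ≡ 0
      bM≡0 = 𝟙-no (flat? μ M) λ fl → ℕₚ.<-irrefl refl (proj₁ fl)

      -- Counting the sum of all Z r s in two ways: by moving a box and then removing one, or by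
      -- removing first.
      ∑Z-moved : ∑ (suc M) (λ s → ∑ s (λ r → Z r s)) ≡
        G (suc N) μ + (∑ M (λ p → ∑ (suc p) a * g (suc p)) + ∑ M H)
      ∑Z-moved = begin
        ∑ (suc M) (λ s → ∑ s (λ r → Z r s))
          ≡⟨ ∑-cong (suc M) (λ s s<m → row s<m) ⟩
        ∑ (suc M) (λ s → ∑ s (λ r → F (suc N) (move r (δ s))) + (∑ s a * g s + H s))
          ≡⟨ trans (∑-+ (suc M) _ _) (cong (_+_ (G (suc N) μ)) (∑-+ (suc M) _ H)) ⟩
        G (suc N) μ + (∑ (suc M) (λ s → ∑ s a * g s) + ∑ (suc M) H)
          ≡⟨ cong (_+_ (G (suc N) μ)) (cong₂ _+_ (∑-head M (λ s → ∑ s a * g s))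
               (trans (cong (λ t → ∑ M H + t * ∑ M (λ r → f r (δ M ⊕ δ (suc M)))) bM≡0) (ℕₚ.+-identityʳ _))) ⟩
        G (suc N) μ + (∑ M (λ p → ∑ (suc p) a * g (suc p)) + ∑ M H) ∎
        where
        open ≡-Reasoning
        row : ∀ {s} → s < suc M → ∑ s (λ r → Z r s) ≡ ∑ s (λ r → F (suc N) (move r (δ s))) + (∑ s a * g s + H s)
        row {s} s<m = trans (∑-cong s λ r r<s → Z-moved r<s s<m)
          (trans (∑-+ s _ _) (cong (_+_ (∑ s _)) (trans (∑-+ s _ _) (cong₂ _+_ (∑-*ʳ s (g s) a) (∑-*ˡ s (b s) _)))))

      ∑Z-split : ∑ (suc M) (λ s → ∑ s (λ r → Z r s)) ≡
        ∑ (suc M) (λ i → w i * G N (μ ⊖ δ i)) + (∑ M (λ p → ∑ (suc p) b * g (suc p)) + ∑ M H)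
      ∑Z-split = begin
        ∑ (suc M) (λ s → ∑ s (λ r → Z r s))
          ≡⟨ ∑-cong (suc M) (λ s _ → trans (∑-cong s λ r _ → Z-split r s) (∑-+ s _ _)) ⟩
        ∑ (suc M) (λ s → ∑ s (λ r → ∑ (suc M) (λ i → w i * f r (δ s ⊕ δ i))) + ∑ s (λ r → ∑ (suc M) (λ i → b i * f r (δ s ⊕ δ i))))
          ≡⟨ ∑-+ (suc M) _ _ ⟩
        ∑ (suc M) (λ s → ∑ s (λ r → ∑ (suc M) (λ i → w i * f r (δ s ⊕ δ i)))) +
        ∑ (suc M) (λ s → ∑ s (λ r → ∑ (suc M) (λ i → b i * f r (δ s ⊕ δ i))))
          ≡⟨ cong₂ _+_ chambers (trans (∑-head M _) (trans (∑-cong M λ p → lowered) (∑-+ M _ _))) ⟩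
        ∑ (suc M) (λ i → w i * G N (μ ⊖ δ i)) + (∑ M (λ p → ∑ (suc p) b * g (suc p)) + ∑ M H) ∎
        where
        open ≡-Reasoning
        chambers : ∑ (suc M) (λ s → ∑ s (λ r → ∑ (suc M) (λ i → w i * f r (δ s ⊕ δ i)))) ≡ ∑ (suc M) (λ i → w i * G N (μ ⊖ δ i))
        chambers = trans (∑-cong (suc M) λ s _ → ∑-swap s (suc M) λ r i → w i * f r (δ s ⊕ δ i))
          (trans (∑-swap (suc M) (suc M) λ s i → ∑ s λ r → w i * f r (δ s ⊕ δ i))
          (∑-cong (suc M) λ i _ → trans (∑-cong (suc M) λ s _ → trans (∑-*ˡ s (w i) _)
            (cong (w i *_) (∑-cong s λ r _ → F-cong N (⊖-move i r s)))) (∑-*ˡ (suc M) (w i) _)))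

      G-suc : G (suc N) μ ≡ ∑ (suc M) (λ i → w i * G N (μ ⊖ δ i)) + ∑ (suc M) (λ i → b i * g (suc i))
      G-suc = ℕₚ.+-cancelʳ-≡ (∑ M (λ p → ∑ (suc p) a * g (suc p)) + ∑ M H) _ _ (begin
        G (suc N) μ + (A + ∑ M H)
          ≡⟨ trans (sym ∑Z-moved) ∑Z-split ⟩
        W + (∑ M (λ p → ∑ (suc p) b * g (suc p)) + ∑ M H)
          ≡⟨ cong (λ t → W + (t + ∑ M H)) (trans (∑-cong M λ p _ →
               trans (cong (_* g (suc p)) (∑b p)) (ℕₚ.*-distribʳ-+ (g (suc p)) (∑ (suc p) a) (b p))) (∑-+ M _ _)) ⟩
        W + (A + B + ∑ M H)
          ≡⟨ lem W A B (∑ M H) ⟩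
        W + (B + 0) + (A + ∑ M H)
          ≡⟨ cong (λ t → W + (B + t * g (suc M)) + (A + ∑ M H)) (sym bM≡0) ⟩
        W + ∑ (suc M) (λ i → b i * g (suc i)) + (A + ∑ M H) ∎)
        where
        open ≡-Reasoning
        A = ∑ M (λ p → ∑ (suc p) a * g (suc p))
        B = ∑ M (λ p → b p * g (suc p))
        W = ∑ (suc M) (λ i → w i * G N (μ ⊖ δ i))
        lem : ∀ w a b h → w + (a + b + h) ≡ w + (b + 0) + (a + h)
        lem = ℕSolver.solve-∀

  G-zero : ∀ {μ} → Chamber μ → G 0 μ ≡ 0
  G-zero {μ} Cμ = ∑-zero (suc M) λ s s<m → ∑-zero s λ r r<s → 𝟙-no (origin? (μ ⊕ (δ r ⊖ δ s))) λ O →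
    ℤₚ.<⇒≱ (lt r<s (O (ℕₚ.<-trans r<s s<m)) (O s<m)) (chamber-monotone {μ} Cμ r<s s<m)
    where
    lt : ∀ {r s} → r < s → μ r ℤ.+ (δ r r ℤ.- δ s r) ≡ 0ℤ → μ s ℤ.+ (δ r s ℤ.- δ s s) ≡ 0ℤ → μ r ℤ.< μ s
    lt {r} {s} r<s er es rewrite δ-refl r | δ-refl s | δ-off (ℕₚ.<⇒≢ r<s) | δ-off (ℕₚ.>⇒≢ r<s) =
      ℤₚ.<-trans (subst (μ r ℤ.<_) er (subst (ℤ._< μ r ℤ.+ 1ℤ) (ℤₚ.+-identityʳ (μ r)) (ℤₚ.+-monoʳ-< (μ r) (ℤ.+<+ ℕₚ.≤-refl))))
                 (subst (ℤ._< μ s) es (subst (μ s ℤ.+ -[1+ 0 ] ℤ.<_) (ℤₚ.+-identityʳ (μ s)) (ℤₚ.+-monoʳ-< (μ s) ℤ.-<+)))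

  R≡G : ∀ N {μ} → Chamber μ → R N μ ≡ G N μ
  R≡G zero    Cμ = sym (G-zero Cμ)
  R≡G (suc N) {μ} Cμ rewrite 𝟙-yes (chamber? μ) Cμ = trans (ℕₚ.*-identityˡ _) (trans (∑-+ (suc M) _ _)
    (trans (cong (_+ ∑ (suc M) (λ i → 𝟙 (flat? μ i) * F N (μ ⊖ δ (suc i)))) (∑-cong (suc M) λ i _ → step i))
           (sym (G-suc Cμ N))))
    where
    step : ∀ i → R N (μ ⊖ δ i) ≡ 𝟙 (chamber? (μ ⊖ δ i)) * G N (μ ⊖ δ i)
    step i with chamber? (μ ⊖ δ i)
    ... | yes C = trans (R≡G N C) (sym (ℕₚ.+-identityʳ _))
    ... | no ¬C = R-outside N ¬C

  R-constant : ∀ N {μ} → (∀ {j} → j < M → μ j ≡ μ (suc j)) → 0 < M → R N μ ≡ F N (μ ⊕ (δ 0 ⊖ δ M))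
  R-constant N {μ} flat 0<M = trans (R≡G N Cμ) (trans
    (cong (_+ ∑ M (λ r → F N (move Cμ r (δ M))))
      (∑-zero M λ s s<M → ∑-zero s λ r r<s → F-outside N (lower-broken Cμ {r} {s} {δ s} (s<M , flat s<M) (ℕₚ.<⇒≢ r<s)
         (ℤₚ.≤-reflexive (sym (δ-refl s))) (δ-pred s))))
    (∑-single M 0 0<M λ { zero _ 0≢0 → contradiction refl 0≢0
                        ; (suc p) r<M _ → F-outside N (raise-broken Cμ {p} {δ M}
                            (ℕₚ.<-trans ℕₚ.≤-refl r<M , flat (ℕₚ.<-trans ℕₚ.≤-refl r<M)) (0≤δ M p)
                            (δ-off (ℕₚ.>⇒≢ r<M))) }))
    where
    Cμ : Chamber μ
    Cμ j<M = ℤₚ.≤-reflexive (sym (flat j<M))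

-- Cardinalities

card-cong : ∀ {P Q k} → (∀ T → P T → Q T) → (∀ T → Q T → P T) → HasCard P k → HasCard Q k
card-cong f g (L , unique , mem , len) =
  L , unique , (λ T → mk⇔ (f T ∘ to (mem T)) (from (mem T) ∘ g T)) , len

card-empty : ∀ {P} → (∀ T → ¬ P T) → HasCard P 0
card-empty none = [] , [] , (λ T → mk⇔ (λ ()) λ p → contradiction p (none T)) , refl

card-singleton : ∀ {P} T → (∀ U → P U → U ≡ T) → P T → HasCard P 1
card-singleton T only p = T ∷ [] , ([] ∷ []) ,
  (λ U → mk⇔ (λ { (here refl) → p }) (here ∘ only U)) , refl

card-⊎ : ∀ {P Q k l} → (∀ T → P T → ¬ Q T) → HasCard P k → HasCard Q l →
         HasCard (λ T → P T ⊎ Q T) (k + l)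
card-⊎ disjoint (L , uL , mL , lenL) (K , uK , mK , lenK) =
  L ++ K ,
  Unique.++⁺ uL uK (λ (p , q) → disjoint _ (to (mL _) p) (to (mK _) q)) ,
  (λ T → mk⇔ ([ inj₁ ∘ to (mL T) , inj₂ ∘ to (mK T) ]′ ∘ ∈-++⁻ L)
             [ ∈-++⁺ˡ ∘ from (mL T) , ∈-++⁺ʳ L ∘ from (mK T) ]′) ,
  trans (length-++ L) (cong₂ _+_ lenL lenK)

card-× : ∀ {A : Set} {P k} (a? : Dec A) → HasCard P k → HasCard (λ T → A × P T) (𝟙 a? * k)
card-× {k = k} (yes a) c = subst (HasCard _) (sym (ℕₚ.+-identityʳ k)) (card-cong (λ T p → a , p) (λ T → proj₂) c)
card-× (no ¬a) c = card-empty λ T → ¬a ∘ proj₁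

card-image : ∀ {P k} (f : Tableau → Tableau) → (∀ {T U} → f T ≡ f U → T ≡ U) → HasCard P k →
             HasCard (λ T → ∃ λ U → T ≡ f U × P U) k
card-image f inj (L , unique , mem , len) =
  map f L , Unique.map⁺ inj unique ,
  (λ T → mk⇔ (λ p → let U , U∈L , eq = ∈-map⁻ f p in U , eq , to (mem U) U∈L)
             (λ { (U , refl , p) → ∈-map⁺ f (from (mem U) p) })) ,
  trans (length-map f L) len

card-preimage : ∀ {Q k} (f : Tableau → Tableau) → (∀ {T U} → f T ≡ f U → T ≡ U) →
                (∀ T → Q T → ∃ λ U → T ≡ f U) → HasCard Q k → HasCard (Q ∘ f) k
card-preimage {Q} f inj onto (L , unique , mem , len) with lift L (All.tabulate λ {T} → onto T ∘ to (mem T))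
  where
  lift : ∀ L → All (λ T → ∃ λ U → T ≡ f U) L → ∃ λ K → L ≡ map f K
  lift []      []                = [] , refl
  lift (_ ∷ L) ((U , refl) ∷ ps) = Product.map (U ∷_) (cong (f U ∷_)) (lift L ps)
... | K , refl =
  K , Unique.map⁻ unique ,
  (λ T → mk⇔ (to (mem (f T)) ∘ ∈-map⁺ f)
             (λ q → let U , U∈K , eq = ∈-map⁻ f (from (mem (f T)) q) in subst (_∈ K) (sym (inj eq)) U∈K)) ,
  trans (sym (length-map f K)) len

card-∑ : ∀ n {P : ℕ → Tableau → Set} {c : ℕ → ℕ} →
         (∀ {i j T} → i < n → j < n → P i T → P j T → i ≡ j) →
         (∀ {i} → i < n → HasCard (P i) (c i)) →
         HasCard (λ T → ∃ λ i → i < n × P i T) (∑ n c)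
card-∑ zero    disjoint card = card-empty λ { T (_ , () , _) }
card-∑ (suc n) {P} disjoint card = card-cong join split
  (card-⊎ (λ { T (i , i<n , p) q → ℕₚ.<⇒≢ i<n (disjoint (ℕₚ.m<n⇒m<1+n i<n) ℕₚ.≤-refl p q) })
    (card-∑ n (λ i<n j<n → disjoint (ℕₚ.m<n⇒m<1+n i<n) (ℕₚ.m<n⇒m<1+n j<n)) (card ∘ ℕₚ.m<n⇒m<1+n))
    (card ℕₚ.≤-refl))
  where
  join : ∀ T → (∃ λ i → i < n × P i T) ⊎ P n T → ∃ λ i → i < suc n × P i T
  join T (inj₁ (i , i<n , p)) = i , ℕₚ.m<n⇒m<1+n i<n , p
  join T (inj₂ p) = n , ℕₚ.≤-refl , p
  split : ∀ T → (∃ λ i → i < suc n × P i T) → (∃ λ i → i < n × P i T) ⊎ P n T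
  split T (i , i<1+n , p) with ℕₚ.m≤n⇒m<n∨m≡n (ℕₚ.≤-pred i<1+n)
  ... | inj₁ i<n  = inj₁ (i , i<n , p)
  ... | inj₂ refl = inj₂ p

-- Inversions under appending an entry and exchanging rows

Longer : List ℕ → List ℕ → Set
Longer r s = length s ≤ length r

append : ℕ → ℕ → Tableau → Tableau
append i       v []      = []
append zero    v (r ∷ T) = (r ∷ʳ v) ∷ T
append (suc i) v (r ∷ T) = r ∷ append i v T

swapRows : ℕ → Tableau → Tableau
swapRows zero    (r ∷ s ∷ T) = s ∷ r ∷ T
swapRows (suc i) (r ∷ T)     = r ∷ swapRows i T
swapRows _       T           = T

rowLength : ℕ → Tableau → ℕ
rowLength i       []      = 0
rowLength zero    (r ∷ T) = length r
rowLength (suc i) (r ∷ T) = rowLength i T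

<ᵇ-true : ∀ {x y} → x < y → (x <ᵇ y) ≡ true
<ᵇ-true x<y = to T-≡ (ℕₚ.<⇒<ᵇ x<y)

<ᵇ-false : ∀ {x y} → y ≤ x → (x <ᵇ y) ≡ false
<ᵇ-false {x} {y} y≤x with x <ᵇ y in eq
... | false = refl
... | true  = contradiction (ℕₚ.<ᵇ⇒< x y (from T-≡ eq)) (ℕₚ.≤⇒≯ y≤x)

<ᵇ-swap : ∀ {A : Set} {x y} {a b : A} → x ≢ y → (if x <ᵇ y then a else b) ≡ (if y <ᵇ x then b else a)
<ᵇ-swap {x = x} {y} x≢y with ℕₚ.<-cmp x y
... | tri< x<y _ _ rewrite <ᵇ-true x<y | <ᵇ-false (ℕₚ.<⇒≤ x<y) = refl
... | tri≈ _ x≡y _ = contradiction x≡y x≢y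
... | tri> _ _ y<x rewrite <ᵇ-true y<x | <ᵇ-false (ℕₚ.<⇒≤ y<x) = refl

length-∷ʳ : ∀ {A : Set} (xs : List A) {x} → length (xs ∷ʳ x) ≡ suc (length xs)
length-∷ʳ xs = trans (length-++ xs) (ℕₚ.+-comm (length xs) 1)

rowPairInv-[] : ∀ r → rowPairInv r [] ≡ 0
rowPairInv-[] []          = refl
rowPairInv-[] (x ∷ [])    = refl
rowPairInv-[] (x ∷ y ∷ r) = refl

rowPairInv-append-upper : ∀ {v} r s → length s ≤ length r → rowPairInv (r ∷ʳ v) s ≡ rowPairInv r s
rowPairInv-append-upper []          []          le = refl
rowPairInv-append-upper (x ∷ [])    []          le = refl
rowPairInv-append-upper (x ∷ y ∷ r) []          le = refl
rowPairInv-append-upper (x ∷ [])    (a ∷ [])    le = refl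
rowPairInv-append-upper (x ∷ [])    (a ∷ b ∷ s) (s≤s ())
rowPairInv-append-upper {v} (x ∷ y ∷ r) (a ∷ []) le =
  cong (pairInv (x , just y) (a , nothing) +_) (trans (rowPairInv-[] (y ∷ r ∷ʳ v)) (sym (rowPairInv-[] (y ∷ r))))
rowPairInv-append-upper {v} (x ∷ y ∷ r) (a ∷ b ∷ s) (s≤s le) =
  cong (pairInv (x , just y) (a , just b) +_) (rowPairInv-append-upper {v} (y ∷ r) (b ∷ s) le)

rowPairInv-append-lower : ∀ {v} r s → length s < length r → All (_< v) r → rowPairInv r (s ∷ʳ v) ≡ rowPairInv r s
rowPairInv-append-lower (x ∷ [])    []       le (x<v ∷ _) rewrite <ᵇ-true x<v = refl
rowPairInv-append-lower (x ∷ y ∷ r) []       le (x<v ∷ _) rewrite <ᵇ-true x<v = rowPairInv-[] (y ∷ r)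
rowPairInv-append-lower (x ∷ [])    (a ∷ s) (s≤s ())
rowPairInv-append-lower {v} (x ∷ y ∷ r) (a ∷ []) (s≤s le) (x<v ∷ y<v ∷ r<v)
  = cong₂ _+_ first (rowPairInv-append-lower (y ∷ r) [] (s≤s z≤n) (y<v ∷ r<v))
  where
  first : pairInv (x , just y) (a , just v) ≡ pairInv (x , just y) (a , nothing)
  first rewrite <ᵇ-true y<v | <ᵇ-false (ℕₚ.<⇒≤ y<v) = refl
rowPairInv-append-lower {v} (x ∷ y ∷ r) (a ∷ b ∷ s) (s≤s le) (x<v ∷ <v) =
  cong (pairInv (x , just y) (a , just b) +_) (rowPairInv-append-lower (y ∷ r) (b ∷ s) le <v)

Distinct : List ℕ → List ℕ → Set
Distinct r s = All (λ a → All (a ≢_) s) r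

rowPairInv-swap : ∀ {v} r s → length s ≡ suc (length r) → Distinct r s → All (_< v) s →
  rowPairInv (r ∷ʳ v) s ≡ suc (rowPairInv s (r ∷ʳ v))
rowPairInv-swap {v} [] (a ∷ []) refl [] (a<v ∷ []) rewrite <ᵇ-true a<v | <ᵇ-false (ℕₚ.<⇒≤ a<v) = refl
rowPairInv-swap {v} (x ∷ []) (a ∷ b ∷ []) refl ((x≢a ∷ _) ∷ []) (_ ∷ <v) =
  trans (cong₂ _+_ (<ᵇ-swap x≢a) (rowPairInv-swap [] (b ∷ []) refl [] <v))
        (ℕₚ.+-suc _ _)
rowPairInv-swap {v} (x ∷ y ∷ r) (a ∷ b ∷ s) eq ((x≢a ∷ _) ∷ d) (_ ∷ <v) =
  trans (cong₂ _+_ (<ᵇ-swap x≢a)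
           (rowPairInv-swap (y ∷ r) (b ∷ s) (ℕₚ.suc-injective eq) (All.map All.tail d) <v))
        (ℕₚ.+-suc _ _)

inversions-append : ∀ {v} i {T} → AllPairs Longer T → AllPairs Longer (append i v T) → All (All (_< v)) T →
  inversions (append i v T) ≡ inversions T
inversions-append i       {[]}    _ _ _ = refl
inversions-append {v} zero {r ∷ T} (long ∷ _) _ _ = cong (_+ inversions T) (go T long)
  where
  go : ∀ T → All (Longer r) T → sum (map (rowPairInv (r ∷ʳ v)) T) ≡ sum (map (rowPairInv r) T)
  go []      []       = refl
  go (s ∷ T) (l ∷ ls) = cong₂ _+_ (rowPairInv-append-upper r s l) (go T ls)
inversions-append {v} (suc i) {r ∷ T} (_ ∷ ps) (long ∷ qs) (r<v ∷ <v) =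
  cong₂ _+_ (go i T long) (inversions-append i ps qs <v)
  where
  go : ∀ i T → All (Longer r) (append i v T) → sum (map (rowPairInv r) (append i v T)) ≡ sum (map (rowPairInv r) T)
  go i       []      _        = refl
  go zero    (s ∷ T) (l ∷ _)  = cong (_+ sum (map (rowPairInv r) T))
    (rowPairInv-append-lower r s (subst (_≤ length r) (length-∷ʳ s) l) r<v)
  go (suc i) (s ∷ T) (_ ∷ ls) = cong (rowPairInv r s +_) (go i T ls)

swapRows-↭ : ∀ i T → swapRows i T ↭ T
swapRows-↭ zero    []          = ↭.refl
swapRows-↭ zero    (r ∷ [])    = ↭.refl
swapRows-↭ zero    (r ∷ s ∷ T) = swap s r ↭.refl
swapRows-↭ (suc i) []          = ↭.refl
swapRows-↭ (suc i) (r ∷ T)     = prep r (swapRows-↭ i T)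

append-swapRows : ∀ i v T → suc i < length T → append (suc i) v (swapRows i T) ≡ swapRows i (append i v T)
append-swapRows zero    v (r ∷ s ∷ T) _         = refl
append-swapRows zero    v (r ∷ [])    (s≤s ())
append-swapRows (suc i) v (r ∷ T)     (s≤s i<n) = cong (r ∷_) (append-swapRows i v T i<n)

swapRows-involutive : ∀ i T → swapRows i (swapRows i T) ≡ T
swapRows-involutive zero    []          = refl
swapRows-involutive zero    (r ∷ [])    = refl
swapRows-involutive zero    (r ∷ s ∷ T) = refl
swapRows-involutive (suc i) []          = refl
swapRows-involutive (suc i) (r ∷ T)     = cong (r ∷_) (swapRows-involutive i T)

swapRows-injective : ∀ i {T U} → swapRows i T ≡ swapRows i U → T ≡ U
swapRows-injective i {T} {U} eq =
  trans (sym (swapRows-involutive i T)) (trans (cong (swapRows i) eq) (swapRows-involutive i U))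

inversions-swapRows : ∀ {v} i {T} → suc i < length T → rowLength (suc i) T ≡ suc (rowLength i T) →
  AllPairs Distinct T → All (All (_< v)) T →
  inversions (append i v T) ≡ suc (inversions (append (suc i) v (swapRows i T)))
inversions-swapRows zero {r ∷ []} (s≤s ())
inversions-swapRows {v} zero {r ∷ s ∷ T} _ len ((d ∷ _) ∷ _) (_ ∷ s<v ∷ _)
  rewrite rowPairInv-swap r s len d s<v = cong suc 
  (lem (rowPairInv s (r ∷ʳ v)) (sum (map (rowPairInv (r ∷ʳ v)) T)) (sum (map (rowPairInv s) T)) (inversions T))
  where
  lem : ∀ a b c d → a + b + (c + d) ≡ a + c + (b + d)
  lem = ℕSolver.solve-∀
inversions-swapRows {v} (suc i) {r ∷ T} (s≤s i<n) len (_ ∷ ds) (_ ∷ <v) =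
  trans (cong₂ _+_ same (inversions-swapRows i i<n len ds <v)) (ℕₚ.+-suc _ _)
  where
  same : sum (map (rowPairInv r) (append i v T)) ≡ sum (map (rowPairInv r) (append (suc i) v (swapRows i T)))
  same rewrite append-swapRows i v T i<n =
    sym (sum-↭ (↭.map⁺ (rowPairInv r) (swapRows-↭ i (append i v T))))

append-cancel : ∀ i v {T U} → append i v T ≡ append i v U → T ≡ U
append-cancel zero    v {[]}    {[]}    _  = refl
append-cancel zero    v {r ∷ T} {s ∷ U} eq with ∷-injective eq
... | eq₁ , refl = cong (_∷ T) (∷ʳ-injectiveˡ r s eq₁)
append-cancel (suc i) v {[]}    {[]}    _  = refl
append-cancel (suc i) v {r ∷ T} {s ∷ U} eq with ∷-injective eq
... | refl , eq₂ = cong (r ∷_) (append-cancel i v eq₂)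

append-index : ∀ {v} i j {T U} → i < length T → j < length U → All (All (_< v)) T → All (All (_< v)) U →
  append i v T ≡ append j v U → i ≡ j
append-index zero    zero    _ _ _ _ _ = refl
append-index zero    (suc j) {r ∷ T} {s ∷ U} _ _ _ (s<v ∷ _) eq with ∷-injective eq
... | refl , _ = contradiction (All.head (proj₂ (All.++⁻ r s<v))) (ℕₚ.<-irrefl refl)
append-index (suc i) zero    {r ∷ T} {s ∷ U} _ _ (r<v ∷ _) _ eq with ∷-injective eq
... | refl , _ = contradiction (All.head (proj₂ (All.++⁻ s r<v))) (ℕₚ.<-irrefl refl)
append-index (suc i) (suc j) {r ∷ T} {s ∷ U} (s≤s i<n) (s≤s j<n) (_ ∷ T<v) (_ ∷ U<v) eq =
  cong suc (append-index i j i<n j<n T<v U<v (proj₂ (∷-injective eq)))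

-- Tableaux of a given shape

length-append : ∀ i v T → length (append i v T) ≡ length T
length-append zero    v []      = refl
length-append zero    v (r ∷ T) = refl
length-append (suc i) v []      = refl
length-append (suc i) v (r ∷ T) = cong suc (length-append i v T)

rowLength-append-≡ : ∀ i v T → i < length T → rowLength i (append i v T) ≡ suc (rowLength i T)
rowLength-append-≡ zero    v (r ∷ T) _         = length-∷ʳ r
rowLength-append-≡ (suc i) v (r ∷ T) (s≤s i<n) = rowLength-append-≡ i v T i<n

rowLength-append-≢ : ∀ i j v T → i ≢ j → rowLength j (append i v T) ≡ rowLength j T
rowLength-append-≢ zero    j       v []      i≢j = refl
rowLength-append-≢ (suc i) j       v []      i≢j = refl
rowLength-append-≢ zero    zero    v (r ∷ T) i≢j = contradiction refl i≢j
rowLength-append-≢ zero    (suc j) v (r ∷ T) i≢j = refl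
rowLength-append-≢ (suc i) zero    v (r ∷ T) i≢j = refl
rowLength-append-≢ (suc i) (suc j) v (r ∷ T) i≢j = rowLength-append-≢ i j v T (i≢j ∘ cong suc)

rowLength-append : ∀ i j v T → i < length T →
  ℤ.+ rowLength j (append i v T) ℤ.- δ i j ≡ ℤ.+ rowLength j T
rowLength-append i j v T i<n with i ℕ.≟ j
... | yes refl rewrite rowLength-append-≡ i v T i<n | δ-refl i = refl
... | no i≢j rewrite rowLength-append-≢ i j v T i≢j | δ-off i≢j = ℤₚ.+-identityʳ _

rowLength-swapRows-upper : ∀ p T → suc p < length T → rowLength p (swapRows p T) ≡ rowLength (suc p) T
rowLength-swapRows-upper zero    (r ∷ [])    (s≤s ())
rowLength-swapRows-upper zero    (r ∷ s ∷ T) _         = refl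
rowLength-swapRows-upper (suc p) (r ∷ T)     (s≤s p<n) = rowLength-swapRows-upper p T p<n

rowLength-swapRows-lower : ∀ p T → suc p < length T → rowLength (suc p) (swapRows p T) ≡ rowLength p T
rowLength-swapRows-lower zero    (r ∷ [])    (s≤s ())
rowLength-swapRows-lower zero    (r ∷ s ∷ T) _         = refl
rowLength-swapRows-lower (suc p) (r ∷ T)     (s≤s p<n) = rowLength-swapRows-lower p T p<n

rowLength-swapRows-other : ∀ p j T → p ≢ j → suc p ≢ j → rowLength j (swapRows p T) ≡ rowLength j T
rowLength-swapRows-other zero    j             []          _ _ = refl
rowLength-swapRows-other zero    j             (r ∷ [])    _ _ = refl
rowLength-swapRows-other zero    zero          (r ∷ s ∷ T) a _ = contradiction refl a
rowLength-swapRows-other zero    (suc zero)    (r ∷ s ∷ T) _ b = contradiction refl b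
rowLength-swapRows-other zero    (suc (suc j)) (r ∷ s ∷ T) _ _ = refl
rowLength-swapRows-other (suc p) j             []          _ _ = refl
rowLength-swapRows-other (suc p) zero          (r ∷ T)     _ _ = refl
rowLength-swapRows-other (suc p) (suc j)       (r ∷ T)     a b =
  rowLength-swapRows-other p j T (a ∘ cong suc) (b ∘ cong suc)

concat-append : ∀ i v T → i < length T → concat (append i v T) ↭ v ∷ concat T
concat-append zero    v (r ∷ T) _         = ↭.++⁺ʳ (concat T) (↭-sym (↭.∷↭∷ʳ v r))
concat-append (suc i) v (r ∷ T) (s≤s i<n) = ↭-trans (↭.++⁺ˡ r (concat-append i v T i<n)) (↭.shift v r (concat T))

concat-↭ : ∀ {T U : Tableau} → T ↭ U → concat T ↭ concat U
concat-↭ ↭.refl            = ↭-refl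
concat-↭ (prep r p)        = ↭.++⁺ˡ r (concat-↭ p)
concat-↭ (↭.swap {T} r s p) = ↭-trans (↭.++⁺ˡ r (↭.++⁺ˡ s (concat-↭ p))) (↭.shifts r s)
concat-↭ (↭.trans p q)     = ↭-trans (concat-↭ p) (concat-↭ q)

labels : ℕ → List ℕ
labels N = map suc (upTo N)

labels-suc : ∀ N → labels (suc N) ↭ suc N ∷ labels N
labels-suc N = ↭-trans
  (↭.↭-reflexive (trans (cong (map suc) (sym (upTo-∷ʳ N))) (map-++ suc (upTo N) (N ∷ []))))
  (↭-sym (↭.∷↭∷ʳ (suc N) (labels N)))

labels-< : ∀ N → All (_< suc N) (labels N)
labels-< N = All.map⁺ (All.applyUpTo⁺₁ _ N s≤s)

labels-unique : ∀ N → Unique (labels N)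
labels-unique N = Unique.map⁺ ℕₚ.suc-injective (Unique.upTo⁺ N)

Unique-++⁻ : ∀ (xs : List ℕ) {ys} → Unique (xs ++ ys) → All (λ a → All (a ≢_) ys) xs × Unique ys
Unique-++⁻ []       u       = [] , u
Unique-++⁻ (x ∷ xs) (p ∷ u) = Product.map (proj₂ (All.++⁻ xs p) ∷_) (λ q → q) (Unique-++⁻ xs u)

Unique⇒Distinct : ∀ T → Unique (concat T) → AllPairs Distinct T
Unique⇒Distinct []      _ = []
Unique⇒Distinct (r ∷ T) u with Unique-++⁻ r u
... | p , q = transpose T (All.map All.concat⁻ p) ∷ Unique⇒Distinct T q
  where
  transpose : ∀ U → All (λ a → All (All (a ≢_)) U) r → All (Distinct r) U
  transpose []      _ = []
  transpose (s ∷ U) p = All.map All.head p ∷ transpose U (All.map All.tail p)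

ends-in-maximum : ∀ {v r} → Linked _<_ r → All (_≤ v) r → v ∈ r → ∃ λ s → r ≡ s ∷ʳ v
ends-in-maximum [-]       _               (here refl) = [] , refl
ends-in-maximum (v<y ∷ _) (_ ∷ y≤v ∷ _)   (here refl) = contradiction y≤v (ℕₚ.<⇒≱ v<y)
ends-in-maximum [-]       _               (there ())
ends-in-maximum {r = x ∷ _} (_ ∷ l) (_ ∷ ≤v) (there v∈) = Product.map (x ∷_) (cong (x ∷_)) (ends-in-maximum l ≤v v∈)

remove-maximum : ∀ {v} T → RowStandard T → All (All (_≤ v)) T → v ∈ concat T →
  ∃ λ i → ∃ λ U → i < length U × T ≡ append i v U
remove-maximum (r ∷ T) (l ∷ ls) (≤v ∷ ≤vs) v∈ with ∈-++⁻ r v∈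
... | inj₁ v∈r with s , refl ← ends-in-maximum l ≤v v∈r = 0 , s ∷ T , s≤s z≤n , refl
... | inj₂ v∈T with i , U , i<n , refl ← remove-maximum T ls ≤vs v∈T = suc i , r ∷ U , s≤s i<n , refl

Linked-∷ʳ⁻ : ∀ r {v} → Linked _<_ (r ∷ʳ v) → Linked _<_ r
Linked-∷ʳ⁻ []          _       = []
Linked-∷ʳ⁻ (x ∷ [])    _       = [-]
Linked-∷ʳ⁻ (x ∷ y ∷ r) (p ∷ l) = p ∷ Linked-∷ʳ⁻ (y ∷ r) l

Linked-∷ʳ⁺ : ∀ {r v} → Linked _<_ r → All (_< v) r → Linked _<_ (r ∷ʳ v)
Linked-∷ʳ⁺ []      []        = [-]
Linked-∷ʳ⁺ [-]     (p ∷ _)   = p ∷ [-]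
Linked-∷ʳ⁺ (p ∷ l) (_ ∷ <v)  = p ∷ Linked-∷ʳ⁺ l <v

RowStandard-append⁻ : ∀ i v T → RowStandard (append i v T) → RowStandard T
RowStandard-append⁻ i       v []      _        = []
RowStandard-append⁻ zero    v (r ∷ T) (l ∷ ls) = Linked-∷ʳ⁻ r l ∷ ls
RowStandard-append⁻ (suc i) v (r ∷ T) (l ∷ ls) = l ∷ RowStandard-append⁻ i v T ls

RowStandard-append⁺ : ∀ i v {T} → All (All (_< v)) T → RowStandard T → RowStandard (append i v T)
RowStandard-append⁺ i       v {[]}    _          _        = []
RowStandard-append⁺ zero    v {r ∷ T} (<v ∷ _)   (l ∷ ls) = Linked-∷ʳ⁺ l <v ∷ ls
RowStandard-append⁺ (suc i) v {r ∷ T} (_ ∷ <vs)  (l ∷ ls) = l ∷ RowStandard-append⁺ i v <vs ls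

longer : ∀ T → (∀ {j} → suc j < length T → rowLength (suc j) T ≤ rowLength j T) → AllPairs Longer T
longer T p = Linked.Linked⇒AllPairs (λ q r → ℕₚ.≤-trans r q) (linked T p)
  where
  linked : ∀ T → (∀ {j} → suc j < length T → rowLength (suc j) T ≤ rowLength j T) → Linked Longer T
  linked []          _ = []
  linked (r ∷ [])    _ = [-]
  linked (r ∷ s ∷ T) p = p {0} (s≤s (s≤s z≤n)) ∷ linked (s ∷ T) λ j<n → p (s≤s j<n)

empty-rows : ∀ (T : Tableau) → concat T ≡ [] → T ≡ replicate (length T) []
empty-rows []      _  = refl
empty-rows (r ∷ T) eq = cong₂ _∷_ (++-conicalˡ r (concat T) eq) (empty-rows T (++-conicalʳ r (concat T) eq))

concat-replicate-[] : ∀ n → concat (replicate n ([] {A = ℕ})) ≡ []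
concat-replicate-[] zero    = refl
concat-replicate-[] (suc n) = concat-replicate-[] n

rowLength-replicate-[] : ∀ j n → rowLength j (replicate n []) ≡ 0
rowLength-replicate-[] j       zero    = refl
rowLength-replicate-[] zero    (suc n) = refl
rowLength-replicate-[] (suc j) (suc n) = rowLength-replicate-[] j n

RowStandard-replicate-[] : ∀ n → RowStandard (replicate n [])
RowStandard-replicate-[] zero    = []
RowStandard-replicate-[] (suc n) = [] ∷ RowStandard-replicate-[] n

inversions-replicate-[] : ∀ n → inversions (replicate n []) ≡ 0
inversions-replicate-[] zero    = refl
inversions-replicate-[] (suc n) = cong₂ _+_ (go n) (inversions-replicate-[] n)
  where
  go : ∀ n → sum (map (rowPairInv []) (replicate n [])) ≡ 0
  go zero    = refl
  go (suc n) = go n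

module Fillings (M : ℕ) where
  open Walks M

  record Filling (N : ℕ) (x : Point) (T : Tableau) : Set where
    constructor filling
    field
      height      : length T ≡ suc M
      widths      : ∀ {j} → j < suc M → ℤ.+ rowLength j T ≡ x j
      entries     : concat T ↭ labels N
      rowStandard : RowStandard T

    small : All (All (_< suc N)) T
    small = All.concat⁻ (↭.All-resp-↭ (↭-sym entries) (labels-< N))

    distinct : AllPairs Distinct T
    distinct = Unique⇒Distinct T (↭ₛ.Unique-resp-↭ (setoid ℕ) (↭⇒↭ₛ (↭-sym entries)) (labels-unique N))

    inside : ∀ {i} → i < suc M → i < length T
    inside = subst (_ <_) (sym height)

    ordered : Chamber x → AllPairs Longer T
    ordered Cx = longer T λ {j} j<n → let j<m = subst (suc j <_) height j<n in
      ℤₚ.drop‿+≤+ (subst₂ ℤ._≤_ (sym (widths j<m)) (sym (widths (ℕₚ.<-trans ℕₚ.≤-refl j<m))) (Cx (ℕₚ.≤-pred j<m)))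

  open Filling

  filling-append : ∀ x {N i U} → i < suc M → Filling N (x ⊖ δ i) U → Filling (suc N) x (append i (suc N) U)
  filling-append x {N} {i} {U} i<m φ = filling
    (trans (length-append i (suc N) U) (height φ))
    (λ {j} j<m → ℤ+.∙-cancelʳ (ℤ.- δ i j) _ _ (trans (rowLength-append i j (suc N) U (inside φ i<m)) (widths φ j<m)))
    (↭-trans (concat-append i (suc N) U (inside φ i<m)) (↭-trans (prep (suc N) (entries φ)) (↭-sym (labels-suc N))))
    (RowStandard-append⁺ i (suc N) (small φ) (rowStandard φ))

  filling-remove : ∀ {N x T} → Filling (suc N) x T →
    ∃ λ i → i < suc M × ∃ λ U → T ≡ append i (suc N) U × Filling N (x ⊖ δ i) U
  filling-remove {N} {x} {T} φ
    with i , U , i<n , refl ← remove-maximum T (rowStandard φ) (All.map (All.map ℕₚ.≤-pred) (small φ))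
                                (↭.∈-resp-↭ (↭-sym (↭-trans (entries φ) (labels-suc N))) (here refl))
    = let h = trans (sym (length-append i (suc N) U)) (height φ) in
      i , subst (i <_) h i<n , U , refl , filling h
        (λ {j} j<m → trans (sym (rowLength-append i j (suc N) U i<n)) (cong (ℤ._- δ i j) (widths φ j<m)))
        (↭.drop-∷ (↭-trans (↭-sym (concat-append i (suc N) U i<n)) (↭-trans (entries φ) (labels-suc N))))
        (RowStandard-append⁻ i (suc N) U (rowStandard φ))

  filling-swapRows : ∀ {N x y p T} → p < M → y p ≡ x (suc p) → y (suc p) ≡ x p →
    (∀ {j} → p ≢ j → suc p ≢ j → y j ≡ x j) → Filling N x T → Filling N y (swapRows p T)
  filling-swapRows {N} {x} {y} {p} {T} p<M upper lower other φ = filling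
    (trans (↭.↭-length (swapRows-↭ p T)) (height φ))
    width
    (↭-trans (concat-↭ (swapRows-↭ p T)) (entries φ))
    (↭.All-resp-↭ (↭-sym (swapRows-↭ p T)) (rowStandard φ))
    where
    p<n = inside φ (s≤s p<M)
    width : ∀ {j} → j < suc M → ℤ.+ rowLength j (swapRows p T) ≡ y j
    width {j} j<m with p ℕ.≟ j | suc p ℕ.≟ j
    ... | yes refl | _ rewrite rowLength-swapRows-upper p T p<n = trans (widths φ (s≤s p<M)) (sym upper)
    ... | no _ | yes refl rewrite rowLength-swapRows-lower p T p<n = trans (widths φ (ℕₚ.<-trans ℕₚ.≤-refl j<m)) (sym lower)
    ... | no a | no b rewrite rowLength-swapRows-other p j T a b = trans (widths φ j<m) (sym (other a b))

  raise-filling : ∀ x {N p T} → Flat x p → Filling N (x ⊖ δ (suc p)) T → Filling N (x ⊖ δ p) (swapRows p T)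
  raise-filling x {N} {p} (p<M , flat) = filling-swapRows p<M
    (cong₂ ℤ._-_ flat (trans (δ-refl p) (sym (δ-refl (suc p)))))
    (cong₂ ℤ._-_ (sym flat) (trans (δ-pred p) (sym (δ-off (ℕₚ.>⇒≢ (ℕₚ.n<1+n p))))))
    (λ {j} a b → cong (λ d → x j ℤ.- d) (trans (δ-off a) (sym (δ-off b))))

  lower-filling : ∀ x {N p T} → Flat x p → Filling N (x ⊖ δ p) T → Filling N (x ⊖ δ (suc p)) (swapRows p T)
  lower-filling x {N} {p} (p<M , flat) = filling-swapRows p<M
    (cong₂ ℤ._-_ flat (trans (δ-off (ℕₚ.>⇒≢ (ℕₚ.n<1+n p))) (sym (δ-pred p))))
    (cong₂ ℤ._-_ (sym flat) (trans (δ-refl (suc p)) (sym (δ-refl p))))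
    (λ {j} a b → cong (λ d → x j ℤ.- d) (trans (δ-off b) (sym (δ-off a))))

  Inverting : ℕ → ℕ → Point → Tableau → Set
  Inverting k N x T = Chamber x × Filling N x T × inversions T ≡ k

  inversions-append-unflat : ∀ x {N i U} → Chamber x → ¬ Flat x i → i < suc M → Filling N (x ⊖ δ i) U →
    inversions (append i (suc N) U) ≡ inversions U
  inversions-append-unflat x {N} {i} Cx ¬fl i<m φ = inversions-append i
    (ordered φ (chamber-⊖δ {x} Cx ¬fl)) (ordered (filling-append x i<m φ) Cx) (small φ)

  inversions-append-flat : ∀ x {N i U} → Flat x i → Filling N (x ⊖ δ i) U →
    inversions (append i (suc N) U) ≡ suc (inversions (append (suc i) (suc N) (swapRows i U)))
  inversions-append-flat x {N} {i} {U} (i<M , flat) φ =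
    inversions-swapRows i (inside φ (s≤s i<M)) (ℤₚ.+-injective width) (distinct φ) (small φ)
    where
    width : ℤ.+ rowLength (suc i) U ≡ 1ℤ ℤ.+ ℤ.+ rowLength i U
    width = begin
      ℤ.+ rowLength (suc i) U         ≡⟨ widths φ (s≤s i<M) ⟩
      x (suc i) ℤ.- δ i (suc i)       ≡⟨ cong₂ ℤ._-_ (sym flat) (δ-pred i) ⟩
      x i ℤ.- 0ℤ                      ≡⟨ lem (x i) ⟩
      1ℤ ℤ.+ (x i ℤ.- 1ℤ)             ≡⟨ cong (λ d → 1ℤ ℤ.+ (x i ℤ.- d)) (sym (δ-refl i)) ⟩
      1ℤ ℤ.+ (x i ℤ.- δ i i)          ≡⟨ cong (λ w → 1ℤ ℤ.+ w) (sym (widths φ (ℕₚ.m<n⇒m<1+n i<M))) ⟩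
      1ℤ ℤ.+ ℤ.+ rowLength i U        ∎
      where
      open ≡-Reasoning
      lem : ∀ a → a ℤ.- 0ℤ ≡ 1ℤ ℤ.+ (a ℤ.- 1ℤ)
      lem = ℤSolver.solve-∀

  Extending : ℕ → (ℕ → Tableau → Set) → Tableau → Set
  Extending N Q T = ∃ λ i → i < suc M × ∃ λ U → T ≡ append i (suc N) U × Q i U

  card-extending : ∀ x {N Q c} → (∀ {i U} → Q i U → Filling N (x ⊖ δ i) U) →
    (∀ {i} → i < suc M → HasCard (Q i) (c i)) → HasCard (Extending N Q) (∑ (suc M) c)
  card-extending x {N} fill card = card-∑ (suc M)
    (λ { {i} {j} i<m j<m (U , refl , q) (V , eq , q′) → append-index i j (inside (fill q) i<m) (inside (fill q′) j<m)
           (small (fill q)) (small (fill q′)) eq })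
    (λ {i} i<m → card-image (append i (suc N)) (append-cancel i (suc N)) (card i<m))

  blank : Tableau
  blank = replicate (suc M) []

  filling-blank : ∀ {x} → Origin x → Filling 0 x blank
  filling-blank O = filling (length-replicate (suc M))
    (λ {j} j<m → trans (cong ℤ.+_ (rowLength-replicate-[] j (suc M))) (sym (O j<m)))
    (↭.↭-reflexive (concat-replicate-[] (suc M))) (RowStandard-replicate-[] (suc M))

  filling-zero : ∀ {x T} → Filling 0 x T → T ≡ blank × Origin x
  filling-zero {x} {T} φ = blanked , λ {j} j<m →
    trans (sym (widths φ j<m)) (cong ℤ.+_ (trans (cong (rowLength j) blanked) (rowLength-replicate-[] j (suc M))))
    where
    blanked = trans (empty-rows T (↭.↭-empty-inv (entries φ))) (cong (λ n → replicate n []) (height φ))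

  std-split : ∀ {N x T} → Inverting 0 (suc N) x T → Extending N (λ i → Inverting 0 N (x ⊖ δ i)) T
  std-split {N} {x} (Cx , φ , inv) with filling-remove φ
  ... | i , i<m , U , refl , ψ with flat? x i
  ...   | no ¬fl = i , i<m , U , refl , chamber-⊖δ {x} Cx ¬fl , ψ , trans (sym (inversions-append-unflat x Cx ¬fl i<m ψ)) inv
  ...   | yes fl with () ← trans (sym (inversions-append-flat x fl ψ)) inv

  inverting-append : ∀ x {k N i U} → Chamber x → i < suc M → Inverting k N (x ⊖ δ i) U → Inverting k (suc N) x (append i (suc N) U)
  inverting-append x Cx i<m (C , φ , inv) = Cx , filling-append x i<m φ ,
    trans (inversions-append-unflat x Cx (λ fl → flat-⊖δ {x} fl C) i<m φ) inv

  card-std : ∀ N x → HasCard (Inverting 0 N x) (F N x)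
  card-std zero x = subst (HasCard _) (ℕₚ.*-identityʳ _) (card-cong
    (λ { _ (O , refl) → (λ {j} j<M → ℤₚ.≤-reflexive (trans (O (s≤s j<M)) (sym (O (ℕₚ.m<n⇒m<1+n j<M))))) ,
                        filling-blank O , inversions-replicate-[] (suc M) })
    (λ { _ (_ , φ , _) → Product.swap (filling-zero φ) })
    (card-× (origin? x) (card-singleton blank (λ _ eq → eq) refl)))
  card-std (suc N) x = card-cong
    (λ { _ (Cx , i , i<m , _ , refl , p) → inverting-append x Cx i<m p })
    (λ _ p → proj₁ p , std-split p)
    (card-× (chamber? x) (card-extending x (λ (_ , φ , _) → φ) λ {i} _ → card-std N (x ⊖ δ i)))

  -- What remains of a tableau with one inversion when its largest entry is deleted from row i.
  One : ℕ → Point → ℕ → Tableau → Set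
  One N x i U = Inverting 1 N (x ⊖ δ i) U ⊎ (Flat x i × Inverting 0 N (x ⊖ δ (suc i)) (swapRows i U))

  one-filling : ∀ x {N i U} → One N x i U → Filling N (x ⊖ δ i) U
  one-filling x (inj₁ (_ , φ , _)) = φ
  one-filling x {N} {i} {U} (inj₂ (fl , _ , φ , _)) = subst (Filling N (x ⊖ δ i)) (swapRows-involutive i U) (raise-filling x fl φ)

  one-split : ∀ {N x T} → Inverting 1 (suc N) x T → Extending N (One N x) T
  one-split {N} {x} (Cx , φ , inv) with filling-remove φ
  ... | i , i<m , U , refl , ψ with flat? x i
  ...   | no ¬fl = i , i<m , U , refl , inj₁ (chamber-⊖δ {x} Cx ¬fl , ψ , trans (sym (inversions-append-unflat x Cx ¬fl i<m ψ)) inv)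
  ...   | yes fl with flat? x (suc i)
  ...     | no ¬fl′ = i , i<m , U , refl , inj₂ (fl , chamber-⊖δ {x} Cx ¬fl′ , lower-filling x fl ψ ,
              trans (sym (inversions-append-unflat x Cx ¬fl′ (s≤s (proj₁ fl)) (lower-filling x fl ψ)))
                    (ℕₚ.suc-injective (trans (sym (inversions-append-flat x fl ψ)) inv)))
  ...     | yes fl′ with () ← trans (sym (inversions-append-flat x fl′ (lower-filling x fl ψ)))
                                    (ℕₚ.suc-injective (trans (sym (inversions-append-flat x fl ψ)) inv))

  one-join : ∀ x {N i U} → Chamber x → i < suc M → One N x i U → Inverting 1 (suc N) x (append i (suc N) U)
  one-join x Cx i<m (inj₁ p) = inverting-append x Cx i<m p
  one-join x Cx i<m q@(inj₂ (fl , p)) = Cx , filling-append x i<m (one-filling x q) ,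
    trans (inversions-append-flat x fl (one-filling x q)) (cong suc (proj₂ (proj₂ (inverting-append x Cx (s≤s (proj₁ fl)) p))))

  card-one : ∀ N x → HasCard (Inverting 1 N x) (R N x)
  card-one zero x = card-empty λ { T (_ , φ , inv) →
    contradiction (trans (sym inv) (trans (cong inversions (proj₁ (filling-zero φ))) (inversions-replicate-[] (suc M)))) λ () }
  card-one (suc N) x = card-cong
    (λ { _ (Cx , i , i<m , _ , refl , p) → one-join x Cx i<m p })
    (λ _ p → proj₁ p , one-split p)
    (card-× (chamber? x) (card-extending x (one-filling x) λ {i} _ → card-⊎
      (λ { _ (C , _) (fl , _) → flat-⊖δ {x} fl C })
      (card-one N (x ⊖ δ i))
      (card-× (flat? x i) (card-preimage (swapRows i) (swapRows-injective i)
        (λ T _ → swapRows i T , sym (swapRows-involutive i T)) (card-std N (x ⊖ δ (suc i)))))))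

at : ℕ → List ℕ → ℕ
at _       []       = 0
at zero    (n ∷ μ)  = n
at (suc j) (n ∷ μ)  = at j μ

rowLength-at : ∀ j T → rowLength j T ≡ at j (map length T)
rowLength-at zero    []      = refl
rowLength-at (suc j) []      = refl
rowLength-at zero    (r ∷ T) = refl
rowLength-at (suc j) (r ∷ T) = rowLength-at j T

at-ext : ∀ μ ν → length μ ≡ length ν → (∀ {j} → j < length μ → at j μ ≡ at j ν) → μ ≡ ν
at-ext []      []      _  _  = refl
at-ext (a ∷ μ) (b ∷ ν) eq at≡ = cong₂ _∷_ (at≡ {0} (s≤s z≤n)) (at-ext μ ν (ℕₚ.suc-injective eq) λ j<n → at≡ (s≤s j<n))

at-replicate : ∀ {j n} a → j < n → at j (replicate n a) ≡ a
at-replicate {zero}  {suc n} a _         = refl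
at-replicate {suc j} {suc n} a (s≤s j<n) = at-replicate a j<n

at-++ˡ : ∀ {j} μ {ν} → j < length μ → at j (μ ++ ν) ≡ at j μ
at-++ˡ {zero}  (a ∷ μ) _         = refl
at-++ˡ {suc j} (a ∷ μ) (s≤s j<n) = at-++ˡ μ j<n

at-length : ∀ μ a → at (length μ) (μ ++ a ∷ []) ≡ a
at-length []      a = refl
at-length (b ∷ μ) a = at-length μ a

module _ {M : ℕ} {x : Point} (μ : Shape)
         (len : length μ ≡ suc M) (points : ∀ {j} → j < suc M → ℤ.+ at j μ ≡ x j) (Cx : Walks.Chamber M x) where

  open Fillings M

  S⇒Inverting : ∀ {k} T → S k μ T → Inverting k (boxes μ) x T
  S⇒Inverting T ((refl , perm) , rows , inv) = Cx ,
    filling (trans (sym (length-map length T)) len) (λ {j} j<m → trans (cong ℤ.+_ (rowLength-at j T)) (points j<m)) perm rows ,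
    inv

  Inverting⇒S : ∀ {k} T → Inverting k (boxes μ) x T → S k μ T
  Inverting⇒S T (_ , filling height widths perm rows , inv) =
    (at-ext (map length T) μ (trans (length-map length T) (trans height (sym len))) (λ {j} j<n →
       ℤₚ.+-injective (let j<m = subst (j <_) (trans (length-map length T) height) j<n in
         trans (cong ℤ.+_ (sym (rowLength-at j T))) (trans (widths j<m) (sym (points j<m))))) , perm) , rows , inv

-- The shape λ̃ with its last row kept even when it has length zero.
withLastRow : ℕ → ℕ → Shape
withLastRow n k = (suc (suc n) ∷ replicate k (suc n)) ++ n ∷ []

boxes-withLastRow : ∀ n k → boxes (rectangle (suc n) (suc (suc k))) ≡ boxes (withLastRow n k)
boxes-withLastRow n k = trans (lem n (sum (replicate k (suc n))))
  (cong (suc (suc n) +_) (sym (sum-++ (replicate k (suc n)) (n ∷ []))))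
  where
  lem : ∀ n s → suc n + (suc n + s) ≡ suc (suc n) + (s + (n + 0))
  lem = ℕSolver.solve-∀

length-withLastRow : ∀ n k → length (withLastRow n k) ≡ suc (suc k)
length-withLastRow n k = cong suc (trans (length-++ (replicate k (suc n)))
  (trans (ℕₚ.+-comm _ 1) (cong suc (length-replicate k))))

at-withLastRow : ∀ n k {j} → j < suc (suc k) → ℤ.+ at j (withLastRow n k) ≡ ℤ.+ suc n ℤ.+ (δ 0 j ℤ.- δ (suc k) j)
at-withLastRow n k {zero} _ rewrite δ-refl 0 | δ-off (ℕₚ.1+n≢0 {k}) = cong ℤ.+_ (ℕₚ.+-comm 1 (suc n))
at-withLastRow n k {suc j} (s≤s j<1+k) rewrite δ-off (ℕₚ.0≢1+n {j}) with ℕₚ.m≤n⇒m<n∨m≡n (ℕₚ.≤-pred j<1+k)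
... | inj₁ j<k rewrite δ-off (ℕₚ.>⇒≢ (s≤s j<k)) =
  cong ℤ.+_ (trans (trans (at-++ˡ (replicate k (suc n)) (subst (j <_) (sym (length-replicate k)) j<k)) (at-replicate (suc n) j<k))
                   (sym (ℕₚ.+-identityʳ (suc n))))
... | inj₂ refl rewrite δ-refl (suc k) =
  cong ℤ.+_ (trans (cong (λ i → at i (replicate k (suc n) ++ n ∷ [])) (sym (length-replicate k))) (at-length (replicate k (suc n)) n))

addEmptyRow : Tableau → Tableau
addEmptyRow T = T ++ [] ∷ []

inversions-addEmptyRow : ∀ T → inversions (addEmptyRow T) ≡ inversions T
inversions-addEmptyRow []      = refl
inversions-addEmptyRow (r ∷ T) = cong₂ _+_ (go T) (inversions-addEmptyRow T)
  where
  go : ∀ U → sum (map (rowPairInv r) (addEmptyRow U)) ≡ sum (map (rowPairInv r) U)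
  go []      = trans (ℕₚ.+-identityʳ _) (rowPairInv-[] r)
  go (s ∷ U) = cong (rowPairInv r s +_) (go U)

concat-addEmptyRow : ∀ T → concat (addEmptyRow T) ≡ concat T
concat-addEmptyRow T = trans (sym (concat-++ T ([] ∷ []))) (++-identityʳ (concat T))

boxes-addEmptyRow : ∀ μ → boxes (μ ++ 0 ∷ []) ≡ boxes μ
boxes-addEmptyRow μ = trans (sum-++ μ (0 ∷ [])) (ℕₚ.+-identityʳ (boxes μ))

map-length-addEmptyRow : ∀ T → map length (addEmptyRow T) ≡ map length T ++ 0 ∷ []
map-length-addEmptyRow T = map-++ length T ([] ∷ [])

S-addEmptyRow⁺ : ∀ {i} μ T → S i μ T → S i (μ ++ 0 ∷ []) (addEmptyRow T)
S-addEmptyRow⁺ μ T ((refl , perm) , rows , inv) =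
  (map-length-addEmptyRow T , subst₂ (λ l b → l ↭ labels b) (sym (concat-addEmptyRow T)) (sym (boxes-addEmptyRow μ)) perm) ,
  All.++⁺ rows ([] ∷ []) , trans (inversions-addEmptyRow T) inv

S-addEmptyRow⁻ : ∀ {i} μ T → S i (μ ++ 0 ∷ []) (addEmptyRow T) → S i μ T
S-addEmptyRow⁻ μ T ((shape , perm) , rows , inv) =
  (∷ʳ-injectiveˡ (map length T) μ (trans (sym (map-length-addEmptyRow T)) shape) ,
   subst₂ (λ l b → l ↭ labels b) (concat-addEmptyRow T) (boxes-addEmptyRow μ) perm) ,
  proj₁ (All.++⁻ T rows) , trans (sym (inversions-addEmptyRow T)) inv

addEmptyRow-onto : ∀ μ T → map length T ≡ μ ++ 0 ∷ [] → ∃ λ U → T ≡ addEmptyRow U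
addEmptyRow-onto []      ([] ∷ []) _  = [] , refl
addEmptyRow-onto (n ∷ μ) (r ∷ T)   eq = Product.map (r ∷_) (cong (r ∷_)) (addEmptyRow-onto μ T (proj₂ (∷-injective eq)))

card-dropEmptyRow : ∀ {i} μ {c} → HasCard (S i (μ ++ 0 ∷ [])) c → HasCard (S i μ) c
card-dropEmptyRow μ card = card-cong (S-addEmptyRow⁻ μ) (S-addEmptyRow⁺ μ)
  (card-preimage addEmptyRow (∷ʳ-injectiveˡ _ _) (λ { T ((shape , _) , _) → addEmptyRow-onto μ T shape }) card)

card-modified : ∀ n k {c} → HasCard (S 0 (withLastRow n k)) c → HasCard (S 0 (modified n k)) c
card-modified (suc n) k card = card
card-modified zero    k {c} card = subst (λ μ → HasCard (S 0 μ) c) (sym (++-identityʳ (2 ∷ replicate k 1)))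
  (card-dropEmptyRow (2 ∷ replicate k 1) card)

theorem3p1 : (n' k : ℕ) →
    Σ ℕ λ c → HasCard (S 1 (rectangle (suc n') (suc (suc k)))) c
    × HasCard (S 0 (modified n' k)) c
theorem3p1 n' k = F N ν , rectangular , card-modified n' k
  (subst (λ b → HasCard (S 0 (withLastRow n' k)) (F b ν)) (sym (boxes-withLastRow n' k))
    (card-cong (Inverting⇒S μ (length-withLastRow n' k) (at-withLastRow n' k) Cν)
               (S⇒Inverting μ (length-withLastRow n' k) (at-withLastRow n' k) Cν)
               (card-std (boxes μ) ν)))
  where
  open Walks (suc k)
  open Fillings (suc k)
  λ₀ = rectangle (suc n') (suc (suc k))
  μ = withLastRow n' k
  N = boxes λ₀
  x ν : Point
  x _ = ℤ.+ suc n'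
  ν = x ⊕ (δ 0 ⊖ δ (suc k))
  Cx : Chamber x
  Cx _ = ℤₚ.≤-refl
  Cν : Chamber ν
  Cν = move-chamber {x} Cx (s≤s z≤n) (λ ()) (λ fl → ℕₚ.<-irrefl refl (proj₁ fl))
  rectangular : HasCard (S 1 λ₀) (F N ν)
  rectangular = subst (HasCard (S 1 λ₀)) (R-constant N {x} (λ _ → refl) (s≤s z≤n))
    (card-cong (Inverting⇒S λ₀ (length-replicate (suc (suc k))) (λ j<m → cong ℤ.+_ (at-replicate _ j<m)) Cx)
               (S⇒Inverting λ₀ (length-replicate (suc (suc k))) (λ j<m → cong ℤ.+_ (at-replicate _ j<m)) Cx)
               (card-one N x))
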